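{- Let $n\leq m$ be positive integers. Then $B(P_n \square P_m) = 2$ if $n = m = 2$; $B(P_n \square P_m) = 3$ if $n = 2$ and $m \geq 3$; $B(P_n \square P_m) = 4$ if $n=3$ and $m \geq 3$; and $B(P_n \square P_m) = 5$ if $n, m\geq 4$.
   Context: $P_n$ is the path on $n$ vertices. The Cartesian product $G\square H$ has vertex set $V(G)\times V(H)$, with $(u,v)$ adjacent to $(x,y)$ iff either $ux\in E(G)$ and $v=y$, or $u=x$ and $vy\in E(H)$. Bodyguards and Presidents is a two-player game on a finite simple graph $G$. One player controls a set of tokens called bodyguards, the other a single token called the president. First all bodyguards are placed on vertices (several may share a vertex), then the president is placed. The players then alternate turns, bodyguards first; on a player's turn, each token they control either moves to an adjacent vertex or stays put. The president is surrounded if every vertex of the open neighbourhood of the president's vertex is occupied by a bodyguard. The bodyguards win if there is a finite time after which, at the end of every bodyguard turn, the president is surrounded; otherwise the president wins. The bodyguard number $B(G)$ is the minimum number of bodyguards that guarantees a win for the bodyguards on $G$. -}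

module Defs where

open import Data.Nat using (ℕ; zero; suc; _≤_; _<_)
open import Data.Fin using (Fin; toℕ)
open import Data.Product using (Σ; _×_; _,_; proj₁; proj₂)
open import Data.Sum using (_⊎_)
open import Data.List using (List; []; _∷_)
open import Relation.Nullary using (¬_)
open import Relation.Binary.PropositionalEquality using (_≡_)

record Graph : Set₁ where
  field
    V   : Set
    Adj : V → V → Set
open Graph public

Path : ℕ → Graph
Path n = record
  { V   = Fin n
  ; Adj = λ i j → (toℕ j ≡ suc (toℕ i)) ⊎ (toℕ i ≡ suc (toℕ j)) }

_□_ : Graph → Graph → Graph
G □ H = record
  { V   = V G × V H
  ; Adj = λ p q → (Adj G (proj₁ p) (proj₁ q) × proj₂ p ≡ proj₂ q)
                ⊎ (proj₁ p ≡ proj₁ q × Adj H (proj₂ p) (proj₂ q)) }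

module _ (G : Graph) where

  Move : V G → V G → Set
  Move v w = v ≡ w ⊎ Adj G v w

  -- positions of k bodyguards (several may share a vertex)
  Config : ℕ → Set
  Config k = Fin k → V G

  BMove : {k : ℕ} → Config k → Config k → Set
  BMove c c' = ∀ i → Move (c i) (c' i)

  Surrounded : {k : ℕ} → Config k → V G → Set
  Surrounded {k} c p = ∀ w → Adj G p w → Σ (Fin k) λ i → c i ≡ w

  -- History: list of past states (bodyguard config, president vertex), most recent first.
  History : ℕ → Set
  History k = List (Config k × V G)

  record BStrategy (k : ℕ) : Set where
    field
      place : Config k
      move  : History k → (c : Config k) → V G → Σ (Config k) (BMove c)

  -- President strategy: placement after seeing the bodyguards; then,
  -- given the history, the bodyguards' new config and own position, a legal move.
  record PStrategy (k : ℕ) : Set where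
    field
      place : Config k → V G
      move  : History k → Config k → (p : V G) → Σ (V G) (Move p)

  run : {k : ℕ} → BStrategy k → PStrategy k → ℕ → History k × Config k × V G
  run σ τ zero = [] , BStrategy.place σ , PStrategy.place τ (BStrategy.place σ)
  run σ τ (suc t) with run σ τ t
  ... | h , c , p =
    let c' = proj₁ (BStrategy.move σ h c p)
        p' = proj₁ (PStrategy.move τ ((c , p) ∷ h) c' p)
    in ((c , p) ∷ h) , c' , p'

  -- state at the end of the bodyguards' (t+1)-th turn: (b_{t+1}, p_t)
  afterBTurn : {k : ℕ} → BStrategy k → PStrategy k → ℕ → Config k × V G
  afterBTurn σ τ t =
    proj₁ (proj₂ (run σ τ (suc t))) , proj₂ (proj₂ (run σ τ t))

  BodyguardsWin : ℕ → Set
  BodyguardsWin k =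
    Σ (BStrategy k) λ σ → (τ : PStrategy k) →
      Σ ℕ λ N → ∀ t → N ≤ t →
        Surrounded (proj₁ (afterBTurn σ τ t)) (proj₂ (afterBTurn σ τ t))

  BodyguardNumberIs : ℕ → Set
  BodyguardNumberIs k = BodyguardsWin k × (∀ j → j < k → ¬ BodyguardsWin j)

{-# OPTIONS --safe #-}
module Submission where

-- If every neighbour of the president's vertex p is of the form T r p for reflexive
-- homomorphisms T r, then bodyguards standing on the vertices T r p can follow the president
-- forever. Two bodyguards chase one moving target on a grid: one catches its first coordinate
-- and afterwards answers every change of it, the other does the same with the second
-- coordinate, so each move of the target lets one of them come closer. Hence k + 1 bodyguards
-- occupy k targets one after another, and the last bodyguard can occupy a target that stays
-- on a line. It remains to choose targets; for grids of width 2 and 3 the last one is chosen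
-- on a boundary line.
-- Conversely, every neighbour needs a bodyguard. On large grids the president moves among
-- the four central vertices of a 4 × 4 corner, onto which the bodyguards are retracted. If
-- four bodyguards that do not surround p could surround in one move each of p and its two
-- central neighbours, tracing which bodyguard serves which vertex shows that they already
-- surround p; so the president always has an escape.

open import Defs
open import Data.Nat using (ℕ; zero; suc; _+_; _≤_; _<_; _∸_; _^_; s≤s; z≤n; s≤s⁻¹; _≤?_)
import Data.Nat as ℕ
import Data.Nat.Properties as ℕ
open import Data.Fin using (Fin; zero; suc; toℕ; fromℕ; fromℕ<; pred; opposite; inject₁; _↑ˡ_; finToFun; funToFin)
open import Data.Fin.Patterns using (0F; 1F; 2F; 3F; 4F)
open import Data.Fin.Properties using (_≟_; any?; all?; pigeonhole; toℕ<n; toℕ-injective; toℕ-fromℕ<; toℕ-inject₁; opposite-prop; opposite-involutive; finToFun-funToFin)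
open import Data.List using ([]; _∷_)
open import Data.Product using (Σ; ∃; _×_; _,_; proj₁; proj₂; swap)
open import Data.Product.Properties using (≡-dec)
open import Data.Sum using (_⊎_; inj₁; inj₂; [_,_]′)
open import Data.Empty using (⊥; ⊥-elim)
open import Data.Unit using (⊤; tt)
import Data.Vec.Functional as Vector
open import Function using (id; _∘_)
open import Relation.Nullary using (¬_; Dec; yes; no)
open import Relation.Nullary.Decidable using (_×-dec_; _⊎-dec_; _→-dec_; ¬?; map′; toWitness)
open import Relation.Nullary.Negation using (contradiction)
open import Relation.Binary.Definitions using (DecidableEquality; tri<; tri≈; tri>)
open import Relation.Binary.PropositionalEquality using (_≡_; refl; sym; trans; cong; cong₂; subst)

-- Reflexive homomorphisms and moves on paths and grids

Hom : (G H : Graph) → (V G → V H) → Set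
Hom G H f = ∀ {u v} → Move G u v → Move H (f u) (f v)

Grid : ℕ → ℕ → Graph
Grid n m = Path n □ Path m

-- Distance at most one as two inequalities, so that maps of paths can be checked by arithmetic.
Near : ∀ {n} → Fin n → Fin n → Set
Near i j = toℕ i ≤ suc (toℕ j) × toℕ j ≤ suc (toℕ i)

move⇒near : ∀ {n} {i j : Fin n} → Move (Path n) i j → Near i j
move⇒near (inj₁ refl)        = ℕ.n≤1+n _ , ℕ.n≤1+n _
move⇒near (inj₂ (inj₁ j≡1+i)) rewrite j≡1+i = ℕ.m≤n+m _ 2 , ℕ.≤-refl
move⇒near (inj₂ (inj₂ i≡1+j)) rewrite i≡1+j = ℕ.≤-refl , ℕ.m≤n+m _ 2

near⇒move : ∀ {n} {i j : Fin n} → Near i j → Move (Path n) i j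
near⇒move {i = i} {j} (i≤1+j , j≤1+i) with ℕ.<-cmp (toℕ i) (toℕ j)
... | tri< i<j _ _ = inj₂ (inj₁ (ℕ.≤-antisym j≤1+i i<j))
... | tri≈ _ i≡j _ = inj₁ (toℕ-injective i≡j)
... | tri> _ _ j<i = inj₂ (inj₂ (ℕ.≤-antisym i≤1+j j<i))

path-hom : ∀ {n m} {f : Fin n → Fin m} →
  (∀ {i j} → toℕ i ≤ suc (toℕ j) → toℕ (f i) ≤ suc (toℕ (f j))) → Hom (Path n) (Path m) f
path-hom lip mv = let (l , r) = move⇒near mv in near⇒move (lip l , lip r)

path-sym : ∀ {n} {i j : Fin n} → Move (Path n) i j → Move (Path n) j i
path-sym = near⇒move ∘ swap ∘ move⇒near

path-irrefl : ∀ {n} {i : Fin n} → ¬ Adj (Path n) i i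
path-irrefl (inj₁ e) = ℕ.1+n≢n (sym e)
path-irrefl (inj₂ e) = ℕ.1+n≢n (sym e)

module _ {n m : ℕ} where

  move₁ : ∀ {x x' : Fin n} {y : Fin m} → Move (Path n) x x' → Move (Grid n m) (x , y) (x' , y)
  move₁ (inj₁ refl) = inj₁ refl
  move₁ (inj₂ a)    = inj₂ (inj₁ (a , refl))

  move₂ : ∀ {x : Fin n} {y y' : Fin m} → Move (Path m) y y' → Move (Grid n m) (x , y) (x , y')
  move₂ (inj₁ refl) = inj₁ refl
  move₂ (inj₂ a)    = inj₂ (inj₂ (refl , a))

  move-proj₁ : Hom (Grid n m) (Path n) proj₁
  move-proj₁ (inj₁ refl)              = inj₁ refl
  move-proj₁ (inj₂ (inj₁ (a , _)))    = inj₂ a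
  move-proj₁ (inj₂ (inj₂ (refl , _))) = inj₁ refl

  move-swap : Hom (Grid n m) (Grid m n) swap
  move-swap (inj₁ refl)              = inj₁ refl
  move-swap (inj₂ (inj₁ (a , refl))) = inj₂ (inj₂ (refl , a))
  move-swap (inj₂ (inj₂ (refl , a))) = inj₂ (inj₁ (a , refl))

grid-hom : ∀ {n m n' m'} {f : Fin n → Fin m → Fin n'} {g : Fin n → Fin m → Fin m'} →
  (∀ {x x' y} → Move (Path n) x x' → Move (Grid n' m') (f x y , g x y) (f x' y , g x' y)) →
  (∀ {x y y'} → Move (Path m) y y' → Move (Grid n' m') (f x y , g x y) (f x y' , g x y')) →
  Hom (Grid n m) (Grid n' m') (λ (x , y) → f x y , g x y)
grid-hom h₁ h₂ (inj₁ refl)              = inj₁ refl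
grid-hom h₁ h₂ (inj₂ (inj₁ (a , refl))) = h₁ (inj₂ a)
grid-hom h₁ h₂ (inj₂ (inj₂ (refl , a))) = h₂ (inj₂ a)

product-hom : ∀ {n m n' m'} {f : Fin n → Fin n'} {g : Fin m → Fin m'} →
  Hom (Path n) (Path n') f → Hom (Path m) (Path m') g →
  Hom (Grid n m) (Grid n' m') (λ (x , y) → f x , g y)
product-hom f-hom g-hom = grid-hom (move₁ ∘ f-hom) (move₂ ∘ g-hom)

pathMove? : ∀ {n} (i j : Fin n) → Dec (Move (Path n) i j)
pathMove? i j = (i ≟ j) ⊎-dec ((toℕ j ℕ.≟ suc (toℕ i)) ⊎-dec (toℕ i ℕ.≟ suc (toℕ j)))

module _ {n m : ℕ} where

  _≟ᵥ_ : DecidableEquality (V (Grid n m))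
  _≟ᵥ_ = ≡-dec _≟_ _≟_

  gridMove? : (u v : V (Grid n m)) → Dec (Move (Grid n m) u v)
  gridMove? (x , y) (x' , y') = map′
    [ (λ { (mv , refl) → move₁ mv }) , (λ { (refl , mv) → move₂ mv }) ]′
    (λ { (inj₁ refl)              → inj₁ (inj₁ refl , refl)
       ; (inj₂ (inj₁ (a , refl))) → inj₁ (inj₂ a , refl)
       ; (inj₂ (inj₂ (refl , a))) → inj₂ (refl , inj₂ a) })
    ((pathMove? x x' ×-dec (y ≟ y')) ⊎-dec ((x ≟ x') ×-dec pathMove? y y'))

pred-hom : ∀ {n} → Hom (Path n) (Path n) pred
pred-hom = path-hom λ {i} {j} → lip i j
  where
  lip : ∀ {n} (i j : Fin n) → toℕ i ≤ suc (toℕ j) → toℕ (pred i) ≤ suc (toℕ (pred j))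
  lip zero    j       _       = z≤n
  lip (suc i) zero    (s≤s i≤0) rewrite toℕ-inject₁ i = ℕ.≤-trans i≤0 z≤n
  lip (suc i) (suc j) (s≤s i≤1+j) rewrite toℕ-inject₁ i | toℕ-inject₁ j = i≤1+j

opposite-hom : ∀ {n} → Hom (Path n) (Path n) opposite
opposite-hom {n} mv = near⇒move (let (l , r) = move⇒near mv in lip r , lip l)
  where
  lip : ∀ {i j : Fin n} → toℕ j ≤ suc (toℕ i) → toℕ (opposite i) ≤ suc (toℕ (opposite j))
  lip {i} {j} j≤1+i rewrite opposite-prop i | opposite-prop j = begin
    n ∸ suc (toℕ i)              ≤⟨ ℕ.m≤n+m∸n _ 1 ⟩
    suc (n ∸ suc (toℕ i) ∸ 1)    ≡⟨ cong suc (ℕ.∸-+-assoc n (suc (toℕ i)) 1) ⟩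
    suc (n ∸ (suc (toℕ i) + 1))  ≤⟨ s≤s (ℕ.∸-monoʳ-≤ n (ℕ.≤-trans (s≤s j≤1+i) (ℕ.≤-reflexive (ℕ.+-comm 1 _)))) ⟩
    suc (n ∸ suc (toℕ j))        ∎
    where open ℕ.≤-Reasoning

-- The last vertex is a fixed point.
next : ∀ {n} → Fin n → Fin n
next = opposite ∘ pred ∘ opposite

next-hom : ∀ {n} → Hom (Path n) (Path n) next
next-hom = opposite-hom ∘ pred-hom ∘ opposite-hom

pred≡ : ∀ {n} {i j : Fin n} → toℕ i ≡ suc (toℕ j) → pred i ≡ j
pred≡ {i = suc i} e = toℕ-injective (trans (toℕ-inject₁ i) (ℕ.suc-injective e))

next≡ : ∀ {n} {i j : Fin n} → toℕ j ≡ suc (toℕ i) → next i ≡ j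
next≡ {n} {i} {j} e =
  trans (cong opposite (pred≡ opposite-e)) (opposite-involutive j)
  where
  opposite-e : toℕ (opposite i) ≡ suc (toℕ (opposite j))
  opposite-e rewrite opposite-prop i | opposite-prop j | e =
    ℕ.+-∸-assoc 1 (subst (_< n) e (toℕ<n j))

move-next : ∀ {n} (i : Fin n) → Move (Path n) i (next i)
move-next {n} i = subst (λ j → Move (Path n) j (next i)) (opposite-involutive i)
  (opposite-hom (path-sym (move-pred (opposite i))))
  where
  move-pred : ∀ {n} (i : Fin n) → Move (Path n) (pred i) i
  move-pred zero    = inj₁ refl
  move-pred (suc i) = inj₂ (inj₁ (cong suc (sym (toℕ-inject₁ i))))

-- From forcing trees to strategies

module _ (G : Graph) {k : ℕ} (S : Config G k → V G → Set) where

  -- With the bodyguards to move, they can force a state satisfying S, whatever the president does.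
  data Force (c : Config G k) (p : V G) : Set where
    now   : S c p → Force c p
    later : ∀ c' → BMove G c c' → (∀ {p'} → Move G p p' → Force c' p') → Force c p

module Extraction
  (G : Graph) (_≟ⱽ_ : DecidableEquality (V G)) (move? : ∀ u v → Dec (Move G u v))
  {k : ℕ} {S : Config G k → V G → Set}
  (keep : ∀ {c p} → S c p → Σ (Config G k) λ c' →
          BMove G c c' × Surrounded G c' p × (∀ {p'} → Move G p p' → S c' p'))
  (force : ∀ c p → Force G S c p) (c₀ : Config G k)
  where

  respond : ∀ {c p} → Force G S c p → Σ (Config G k) (BMove G c)
  respond (now s)        = let (c' , mv , _) = keep s in c' , mv
  respond (later c' mv _) = c' , mv

  follow : ∀ {c p p'} (w : Force G S c p) → Move G p p' → Force G S (proj₁ (respond w)) p'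
  follow (now s)       m = now (proj₂ (proj₂ (proj₂ (keep s))) m)
  follow (later _ _ f) m = f m

  -- A history is an arbitrary list, so `p'` need not be a legal move away; then `force` supplies a
  -- fresh tree. In an actual play only the first branch occurs.
  continue : ∀ {c p} (w : Force G S c p) → ∀ p' → Force G S (proj₁ (respond w)) p'
  continue {p = p} w p' with move? p p'
  ... | yes m = follow w m
  ... | no  _ = force _ p'

  -- The bodyguards' memory is the rest of the forcing tree, recomputed from the history.
  plan : History G k → Σ (Config G k) λ c → ∀ p → Force G S c p
  plan []            = c₀ , force c₀
  plan ((_ , p) ∷ h) = let w = proj₂ (plan h) p in proj₁ (respond w) , continue w

  strategy : BStrategy G k
  BStrategy.place strategy = c₀
  BStrategy.move strategy h c p with all? (λ i → c i ≟ⱽ proj₁ (plan h) i)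
  ... | yes e = let (c' , mv) = respond (proj₂ (plan h) p)
                in c' , λ i → subst (λ v → Move G v (c' i)) (sym (e i)) (mv i)
  -- Never reached when this strategy is played, by `in-sync`; any legal move would do.
  ... | no  _ = c , λ _ → inj₁ refl

  Node : Set
  Node = Σ (Config G k) λ c → Σ (V G) (Force G S c)

  child : Node → V G → Node
  child (_ , _ , w) p' = proj₁ (respond w) , p' , continue w p'

  Settled : Node → Set
  Settled (_ , _ , now _)       = ⊤
  Settled (_ , _ , later _ _ _) = ⊥

  settled-child : ∀ x {p'} → Move G (proj₁ (proj₂ x)) p' → Settled x → Settled (child x p')
  settled-child (_ , p , now _) {p'} m _ with move? p p'
  ... | yes _  = tt
  ... | no ¬m = contradiction m ¬m

  settled-surrounded : ∀ c p (w : Force G S c p) → Settled (c , p , w) →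
    Surrounded G (proj₁ (respond w)) p
  settled-surrounded _ _ (now s) _ = proj₁ (proj₂ (proj₂ (keep s)))

  module _ (τ : PStrategy G k) where

    hist : ℕ → History G k
    hist t = proj₁ (run G strategy τ t)

    conf : ℕ → Config G k
    conf t = proj₁ (proj₂ (run G strategy τ t))

    pres : ℕ → V G
    pres t = proj₂ (proj₂ (run G strategy τ t))

    pres-move : ∀ t → Move G (pres t) (pres (suc t))
    pres-move t = proj₂ (PStrategy.move τ _ _ (pres t))

    node : ℕ → Node
    node t = proj₁ (plan (hist t)) , pres t , proj₂ (plan (hist t)) (pres t)

    in-sync : ∀ t → conf t ≡ proj₁ (plan (hist t))
    in-sync zero = refl
    in-sync (suc t) with all? (λ i → conf t i ≟ⱽ proj₁ (plan (hist t)) i)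
    ... | yes _ = refl
    ... | no ¬e = contradiction (λ i → cong (λ c → c i) (in-sync t)) ¬e

    eventually-settled : ∀ {c p} (w : Force G S c p) t → node t ≡ (c , p , w) → ∃ λ N → Settled (node N)
    eventually-settled (now s) t e = t , subst Settled (sym e) tt
    eventually-settled {c} {p} (later c' mv f) t e
      with move? p (pres (suc t)) | cong (λ x → child x (pres (suc t))) e
    ... | yes m | e' = eventually-settled (f m) (suc t) e'
    ... | no ¬m | _  = contradiction
      (subst (λ x → Move G (proj₁ (proj₂ x)) (pres (suc t))) e (pres-move t)) ¬m

    settled-forever : ∀ {N} → Settled (node N) → ∀ d → Settled (node (d + N))
    settled-forever s zero    = s
    settled-forever {N} s (suc d) = settled-child (node (d + N)) (pres-move (d + N)) (settled-forever s d)

    surrounded : ∀ t → Settled (node t) → Surrounded G (conf (suc t)) (pres t)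
    surrounded t s = subst (λ c → Surrounded G c (pres t)) (sym (in-sync (suc t)))
      (settled-surrounded _ _ (proj₂ (plan (hist t)) (pres t)) s)

  win : BodyguardsWin G k
  win = strategy , λ τ →
    let (N , s) = eventually-settled τ _ 0 refl
    in N , λ t N≤t → surrounded τ t
      (subst (Settled ∘ node τ) (ℕ.m∸n+n≡m N≤t) (settled-forever τ s (t ∸ N)))

-- Pursuit of a moving target

-- A bodyguard g strictly behind the target x keeps moving in the same direction until
-- it can step onto the target, so k bounds the room it has left.
Chase : ∀ {n} → ℕ → Fin n → Fin n → Set
Chase {n} k g x = (toℕ g < toℕ x × n ≤ toℕ g + k) ⊎ (toℕ x < toℕ g × toℕ g ≤ k)

chase-zero : ∀ {n} {g x : Fin n} → ¬ Chase 0 g x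
chase-zero {g = g} (inj₁ (_ , n≤g)) rewrite ℕ.+-identityʳ (toℕ g) = ℕ.<⇒≱ (toℕ<n g) n≤g
chase-zero (inj₂ (x<g , g≤0)) = ℕ.<⇒≱ x<g (ℕ.≤-trans g≤0 z≤n)

chase-start : ∀ {n k} (g x : Fin n) → n ≤ k → g ≡ x ⊎ Chase k g x
chase-start g x n≤k with ℕ.<-cmp (toℕ g) (toℕ x)
... | tri< g<x _ _ = inj₂ (inj₁ (g<x , ℕ.≤-trans n≤k (ℕ.m≤n+m _ _)))
... | tri≈ _ g≡x _ = inj₁ (toℕ-injective g≡x)
... | tri> _ _ x<g = inj₂ (inj₂ (x<g , ℕ.≤-trans (ℕ.<⇒≤ (toℕ<n g)) n≤k))

-- The target was strictly ahead, so its move cannot take it past the bodyguard: either it is now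
-- within one, or it is still at least two ahead and a step towards it uses up one unit of room.
chase-step : ∀ {n k} {g x x' : Fin n} → Chase (suc k) g x → Move (Path n) x x' →
  Move (Path n) g x' ⊎ Σ (Fin n) λ g' → Adj (Path n) g g' × Chase k g' x'
chase-step {n} {k} {g} {x} {x'} (inj₁ (g<x , n≤g+1+k)) mv with toℕ x' ≤? suc (toℕ g)
... | yes x'≤1+g = inj₁ (near⇒move (ℕ.≤-trans (ℕ.<⇒≤ g<x) (proj₁ (move⇒near mv)) , x'≤1+g))
... | no  x'≰1+g = inj₂ (g' , inj₁ g'≡1+g , inj₁
    ( subst (_< toℕ x') (sym g'≡1+g) 1+g<x'
    , subst (n ≤_) (trans (ℕ.+-suc _ k) (cong (_+ k) (sym g'≡1+g))) n≤g+1+k))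
  where
  1+g<x' : suc (toℕ g) < toℕ x'
  1+g<x' = ℕ.≰⇒> x'≰1+g
  1+g<n : suc (toℕ g) < n
  1+g<n = ℕ.<-trans 1+g<x' (toℕ<n x')
  g' : Fin n
  g' = fromℕ< 1+g<n
  g'≡1+g : toℕ g' ≡ suc (toℕ g)
  g'≡1+g = toℕ-fromℕ< 1+g<n
chase-step {g = suc g} {x} {x'} (inj₂ (x<g , s≤s g≤k)) mv with suc (toℕ g) ≤? suc (toℕ x')
... | yes g≤1+x' = inj₁ (near⇒move (g≤1+x' ,
        ℕ.≤-trans (proj₂ (move⇒near mv)) (ℕ.m≤n⇒m≤1+n x<g)))
... | no  g≰1+x' rewrite sym (toℕ-inject₁ g) =
        inj₂ (inject₁ g , inj₂ refl , inj₂ (s≤s⁻¹ (ℕ.≰⇒> g≰1+x') , g≤k))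

-- The bodyguard first catches the first coordinate of the target; from then on it answers
-- every change of that coordinate and spends all other turns chasing the second one.
Pursue : ∀ {n m} → ℕ → V (Grid n m) → V (Grid n m) → Set
Pursue {n} {m} f (a₁ , a₂) (q₁ , q₂) =
  (∃ λ k → f ≡ k + m × Chase k a₁ q₁) ⊎ (a₁ ≡ q₁ × Chase f a₂ q₂)

pursue-zero : ∀ {n m} {a q : V (Grid n m)} → ¬ Pursue 0 a q
pursue-zero (inj₁ (zero , _ , ch)) = chase-zero ch
pursue-zero (inj₂ (_ , ch))        = chase-zero ch

pursue-start : ∀ {n m} (a q : V (Grid n m)) → a ≡ q ⊎ Pursue (n + m) a q
pursue-start {n} {m} (a₁ , a₂) (q₁ , q₂)
  with chase-start {k = n} a₁ q₁ ℕ.≤-refl | chase-start {k = n + m} a₂ q₂ (ℕ.m≤n+m m n)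
... | inj₂ ch   | _         = inj₂ (inj₁ (n , refl , ch))
... | inj₁ refl | inj₁ refl = inj₁ refl
... | inj₁ refl | inj₂ ch   = inj₂ (inj₂ (refl , ch))

-- The budget falls except when the target changes its first coordinate after that was caught; that
-- turn goes into copying the change.
pursue-step : ∀ {n m f} {a q q' : V (Grid n m)} → Pursue (suc f) a q → Move (Grid n m) q q' →
  Move (Grid n m) a q' ⊎ Σ (V (Grid n m)) λ a' → Move (Grid n m) a a' ×
    (Pursue f a' q' ⊎ (Adj (Path n) (proj₁ q) (proj₁ q') × Pursue (suc f) a' q'))
pursue-step (inj₁ (zero , _ , ch)) mv = contradiction ch chase-zero
pursue-step {m = m} {a = _ , a₂} {q' = q₁' , q₂'} (inj₁ (suc k , refl , ch)) mv
  with chase-step ch (move-proj₁ mv)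
... | inj₂ (a₁' , ad , ch') = inj₂ ((a₁' , a₂) , move₁ (inj₂ ad) , inj₁ (inj₁ (k , refl , ch')))
... | inj₁ mv₁ with chase-start {k = k + m} a₂ q₂' (ℕ.m≤n+m m k)
...   | inj₁ refl = inj₁ (move₁ mv₁)
...   | inj₂ ch'  = inj₂ ((q₁' , a₂) , move₁ mv₁ , inj₁ (inj₂ (refl , ch')))
pursue-step {a = _ , a₂} {q' = q₁' , _} (inj₂ (refl , ch)) (inj₂ (inj₁ (ad , refl))) =
  inj₂ ((q₁' , a₂) , move₁ (inj₂ ad) , inj₂ (ad , inj₂ (refl , ch)))
pursue-step {a = a₁ , _} (inj₂ (refl , ch)) (inj₁ refl) with chase-step ch (inj₁ refl)
... | inj₁ mv = inj₁ (move₂ mv)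
... | inj₂ (a₂' , ad , ch') = inj₂ ((a₁ , a₂') , move₂ (inj₂ ad) , inj₁ (inj₂ (refl , ch')))
pursue-step {a = a₁ , _} (inj₂ (refl , ch)) (inj₂ (inj₂ (refl , ad₂))) with chase-step ch (inj₂ ad₂)
... | inj₁ mv = inj₁ (move₂ mv)
... | inj₂ (a₂' , ad , ch') = inj₂ ((a₁ , a₂') , move₂ (inj₂ ad) , inj₁ (inj₂ (refl , ch')))

-- Occupying all targets of the president's position

module _ {n m : ℕ} where

  private
    G = Grid n m

  -- The bodyguards are to move, hence one move short of their targets. The play decides who gets
  -- which target, so the roles belong to the state.
  record TargetsInReach {k : ℕ} (T : Fin k → V G → V G) (c : Config G k) (p : V G) : Set where
    constructor assign
    field
      role            : Fin k → Fin k
      role-surjective : ∀ r → ∃ λ i → role i ≡ r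
      role-move       : ∀ i → Move G (c i) (T (role i) p)

  Capture : ∀ {k} → (Fin k → V G → V G) → Config G k → V G → Set
  Capture T = Force G (TargetsInReach T)

  capture-cong : ∀ {k T} {c d : Config G k} {p} → (∀ i → c i ≡ d i) → Capture T c p → Capture T d p
  capture-cong e (now (assign ρ sur mv)) = now (assign ρ sur λ i → subst (λ v → Move G v _) (e i) (mv i))
  capture-cong e (later c' mv f) = later c' (λ i → subst (λ v → Move G v (c' i)) (e i) (mv i)) f

  capture-permute : ∀ {k T} {c : Config G k} {p} (π : Fin k → Fin k) → (∀ r → ∃ λ i → π i ≡ r) →
    Capture T c p → Capture T (c ∘ π) p
  capture-permute π π-sur (now (assign ρ ρ-sur mv)) = now (assign (ρ ∘ π) sur (mv ∘ π))
    where
    sur : ∀ r → ∃ λ i → ρ (π i) ≡ r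
    sur r with ρ-sur r
    ... | j , refl with π-sur j
    ...   | i , refl = i , refl
  capture-permute π π-sur (later c' mv f) = later (c' ∘ π) (mv ∘ π) (capture-permute π π-sur ∘ f)

  transpose₀₁ : ∀ {k} → Fin (suc (suc k)) → Fin (suc (suc k))
  transpose₀₁ zero          = suc zero
  transpose₀₁ (suc zero)    = zero
  transpose₀₁ (suc (suc i)) = suc (suc i)

  transpose₀₁-involutive : ∀ {k} (i : Fin (suc (suc k))) → transpose₀₁ (transpose₀₁ i) ≡ i
  transpose₀₁-involutive zero          = refl
  transpose₀₁-involutive (suc zero)    = refl
  transpose₀₁-involutive (suc (suc i)) = refl

  capture-transpose : ∀ {k T} {c : Config G (suc (suc k))} {p} →
    Capture T (c ∘ transpose₀₁) p → Capture T c p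
  capture-transpose {c = c} =
    capture-cong (cong c ∘ transpose₀₁-involutive) ∘
    capture-permute transpose₀₁ (λ r → transpose₀₁ r , transpose₀₁-involutive r)

  -- Since `T zero` is a homomorphism, its bodyguard can follow this target while the others play
  -- on.
  capture-tail : ∀ {k} {T : Fin (suc k) → V G → V G} {c p} → Hom G G (T zero) →
    Move G (c zero) (T zero p) → Capture (T ∘ suc) (c ∘ suc) p → Capture T c p
  capture-tail {k} {T} {c} {p} _ mv₀ (now (assign ρ sur mv)) = now (assign ρ' sur' mv')
    where
    ρ' : Fin (suc k) → Fin (suc k)
    ρ' zero    = zero
    ρ' (suc i) = suc (ρ i)
    sur' : ∀ r → ∃ λ i → ρ' i ≡ r
    sur' zero    = zero , refl
    sur' (suc r) = let (i , e) = sur r in suc i , cong suc e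
    mv' : ∀ i → Move G (c i) (T (ρ' i) p)
    mv' zero    = mv₀
    mv' (suc i) = mv i
  capture-tail {T = T} {c} {p} hom₀ mv₀ (later c' mv f) =
    later (T zero p Vector.∷ c') (λ { zero → mv₀ ; (suc i) → mv i })
      (λ m → capture-tail hom₀ (hom₀ m) (f m))

  -- One bodyguard pursues column first and the other row first: whichever way the target
  -- moves, one of them makes progress.
  duel : ∀ {k} {T : Fin (suc (suc k)) → V G → V G} → Hom G G (T zero) →
    (∀ c p → Move G (c zero) (T zero p) → Capture T c p) →
    ∀ f₀ f₁ c p → Pursue f₀ (c zero) (T zero p) → Pursue f₁ (swap (c (suc zero))) (swap (T zero p)) →
    ∀ {p'} → Move G p p' → Capture T c p'
  duel hom₀ caught zero _ c p u _ = contradiction u pursue-zero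
  duel hom₀ caught (suc _) zero c p _ u = contradiction u pursue-zero
  duel {T = T} hom₀ caught (suc f₀) (suc f₁) c p u₀ u₁ {p'} pp'
    with pursue-step u₀ (hom₀ pp') | pursue-step u₁ (move-swap (hom₀ pp'))
  ... | inj₁ mv | _ = caught c p' mv
  ... | inj₂ _  | inj₁ mv = capture-transpose (caught (c ∘ transpose₀₁) p' (move-swap mv))
  ... | inj₂ (a , mva , r₀) | inj₂ (b , mvb , r₁) = later c' mv' (next-round r₀ r₁)
    where
    c' : Config G _
    c' = a Vector.∷ swap b Vector.∷ λ i → c (suc (suc i))
    mv' : BMove G c c'
    mv' zero          = mva
    mv' (suc zero)    = move-swap mvb
    mv' (suc (suc i)) = inj₁ refl
    next-round : _ → _ → ∀ {p''} → Move G p' p'' → Capture T c' p''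
    next-round (inj₁ v₀)       (inj₁ v₁)       = duel hom₀ caught f₀ f₁ c' p' v₀ v₁
    next-round (inj₁ v₀)       (inj₂ (_ , v₁)) = duel hom₀ caught f₀ (suc f₁) c' p' v₀ v₁
    next-round (inj₂ (_ , v₀)) (inj₁ v₁)       = duel hom₀ caught (suc f₀) f₁ c' p' v₀ v₁
    -- Both pursuers stall only if the target changes both coordinates in one move.
    next-round (inj₂ (ad₁ , _)) (inj₂ (ad₂ , _)) = ⊥-elim (one-coordinate (hom₀ pp') ad₁ ad₂)
      where
      one-coordinate : ∀ {q q' : V G} → Move G q q' →
        Adj (Path n) (proj₁ q) (proj₁ q') → Adj (Path m) (proj₂ q) (proj₂ q') → ⊥
      one-coordinate (inj₁ refl)              ad₁ _   = path-irrefl ad₁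
      one-coordinate (inj₂ (inj₁ (_ , refl))) _   ad₂ = path-irrefl ad₂
      one-coordinate (inj₂ (inj₂ (refl , _))) ad₁ _   = path-irrefl ad₁

  -- A target with constant first coordinate never makes the move that stalls its pursuer.
  solo : ∀ {T : Fin 1 → V G → V G} {z} → Hom G G (T zero) → (∀ p → proj₁ (T zero p) ≡ z) →
    ∀ f c p → Pursue f (c zero) (T zero p) → ∀ {p'} → Move G p p' → Capture T c p'
  solo hom₀ fixed zero c p u _ = contradiction u pursue-zero
  solo {T} hom₀ fixed (suc f) c p u {p'} m with pursue-step u (hom₀ m)
  ... | inj₁ mv = now (assign id (λ r → r , refl) λ { zero → mv })
  ... | inj₂ (a , mv , inj₁ v) =
    later (λ _ → a) (λ { zero → mv }) (solo hom₀ fixed f (λ _ → a) p' v)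
  ... | inj₂ (_ , _ , inj₂ (ad , _)) =
    ⊥-elim (path-irrefl (subst (Adj (Path n) _) (trans (fixed p') (sym (fixed p))) ad))

  capture : ∀ k (T : Fin (suc k) → V G → V G) {z} → (∀ r → Hom G G (T r)) →
    (∀ p → proj₁ (T (fromℕ k) p) ≡ z) → ∀ c p → Capture T c p
  -- One turn of waiting: the pursuit lemmas compare the bodyguard with the vertex that the target
  -- is just leaving.
  capture zero T hom fixed c p = later c (λ _ → inj₁ refl) after
    where
    after : ∀ {p'} → Move G p p' → Capture T c p'
    after m with pursue-start (c zero) (T zero p)
    ... | inj₁ e = now (assign id (λ r → r , refl) λ { zero → subst (λ v → Move G v _) (sym e) (hom zero m) })
    ... | inj₂ u = solo (hom zero) fixed _ c p u m
  capture (suc k) T hom fixed c p = later c (λ _ → inj₁ refl) after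
    where
    caught : ∀ c p → Move G (c zero) (T zero p) → Capture T c p
    caught c p mv = capture-tail (hom zero) mv (capture k (T ∘ suc) (hom ∘ suc) fixed (c ∘ suc) p)
    after : ∀ {p'} → Move G p p' → Capture T c p'
    after {p'} m
      with pursue-start (c zero) (T zero p) | pursue-start (swap (c (suc zero))) (swap (T zero p))
    ... | inj₁ e | _ = caught c p' (subst (λ v → Move G v _) (sym e) (hom zero m))
    ... | inj₂ _ | inj₁ e = capture-transpose (caught (c ∘ transpose₀₁) p'
            (subst (λ v → Move G v _) (sym (cong swap e)) (hom zero m)))
    ... | inj₂ u₀ | inj₂ u₁ = duel (hom zero) caught _ _ c p u₀ u₁ m

  -- Stepping onto all targets surrounds the president by `cover`; the president's next move shifts
  -- each target by at most one, so all stay in reach.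
  targets-win : ∀ k (T : Fin (suc k) → V G → V G) {z} → (∀ r → Hom G G (T r)) →
    (∀ p → proj₁ (T (fromℕ k) p) ≡ z) →
    (∀ p w → Adj G p w → ∃ λ r → T r p ≡ w) → V G → BodyguardsWin G (suc k)
  targets-win k T hom fixed cover v₀ =
    Extraction.win G _≟ᵥ_ gridMove? keep (capture k T hom fixed) (λ _ → v₀)
    where
    keep : ∀ {c p} → TargetsInReach T c p → Σ (Config G (suc k)) λ c' →
      BMove G c c' × Surrounded G c' p × (∀ {p'} → Move G p p' → TargetsInReach T c' p')
    keep {c} {p} (assign ρ sur mv) =
      (λ i → T (ρ i) p) , mv , occupied , λ m → assign ρ sur λ i → hom (ρ i) m
      where
      occupied : Surrounded G (λ i → T (ρ i) p) p
      occupied w ad with cover p w ad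
      ... | r , refl with sur r
      ...   | i , refl = i , refl

-- Targets for the four kinds of grids

win₅ : ∀ n m → BodyguardsWin (Grid (suc n) (suc m)) 5
win₅ n m = targets-win 4 T hom (λ _ → refl) cover (zero , zero)
  where
  G : Graph
  G = Grid (suc n) (suc m)
  T : Fin 5 → V G → V G
  T 0F (x , y) = next x , y
  T 1F (x , y) = pred x , y
  T 2F (x , y) = x , next y
  T 3F (x , y) = x , pred y
  -- The fifth bodyguard serves as second pursuer of the fourth target; its own target can be any
  -- fixed vertex.
  T 4F _       = zero , zero
  hom : ∀ r → Hom G G (T r)
  hom 0F = product-hom next-hom id
  hom 1F = product-hom pred-hom id
  hom 2F = product-hom id next-hom
  hom 3F = product-hom id pred-hom
  hom 4F _ = inj₁ refl
  cover : ∀ p w → Adj G p w → ∃ λ r → T r p ≡ w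
  cover (_ , y) _ (inj₁ (inj₁ e , refl)) = 0F , cong (_, y) (next≡ e)
  cover (_ , y) _ (inj₁ (inj₂ e , refl)) = 1F , cong (_, y) (pred≡ e)
  cover (x , _) _ (inj₂ (refl , inj₁ e)) = 2F , cong (x ,_) (next≡ e)
  cover (x , _) _ (inj₂ (refl , inj₂ e)) = 3F , cong (x ,_) (pred≡ e)

-- Two bodyguards share the president's second coordinate: one stays on side 0, the other is
-- on side 2 exactly when the president is in the middle, and in the middle otherwise.
win₄ : ∀ m → BodyguardsWin (Grid 3 (suc m)) 4
win₄ m = targets-win 3 T hom (λ _ → refl) cover (zero , zero)
  where
  across : Fin 3 → Fin 3
  across 0F = 1F
  across 1F = 2F
  across 2F = 1F
  across-hom : Hom (Path 3) (Path 3) across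
  across-hom = path-hom λ {i} {j} → lip i j
    where
    lip : ∀ i j → toℕ i ≤ suc (toℕ j) → toℕ (across i) ≤ suc (toℕ (across j))
    lip 0F _  _ = s≤s z≤n
    lip 2F _  _ = s≤s z≤n
    lip 1F 0F _ = s≤s (s≤s z≤n)
    lip 1F 1F _ = s≤s (s≤s z≤n)
    lip 1F 2F _ = s≤s (s≤s z≤n)
  G : Graph
  G = Grid 3 (suc m)
  T : Fin 4 → V G → V G
  T 0F (x , y) = x , next y
  T 1F (x , y) = x , pred y
  T 2F (x , y) = across x , y
  T 3F (x , y) = 0F , y
  hom : ∀ r → Hom G G (T r)
  hom 0F = product-hom id next-hom
  hom 1F = product-hom id pred-hom
  hom 2F = product-hom across-hom id
  hom 3F = product-hom (λ _ → inj₁ refl) id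
  cover : ∀ p w → Adj G p w → ∃ λ r → T r p ≡ w
  cover (x , _) _ (inj₂ (refl , inj₁ e)) = 0F , cong (x ,_) (next≡ e)
  cover (x , _) _ (inj₂ (refl , inj₂ e)) = 1F , cong (x ,_) (pred≡ e)
  cover (0F , _) (1F , _) (inj₁ (_ , refl)) = 2F , refl
  cover (1F , _) (0F , _) (inj₁ (_ , refl)) = 3F , refl
  cover (1F , _) (2F , _) (inj₁ (_ , refl)) = 2F , refl
  cover (2F , _) (1F , _) (inj₁ (_ , refl)) = 2F , refl
  cover (0F , _) (0F , _) (inj₁ (a , _)) = contradiction a (path-irrefl {3} {0F})
  cover (1F , _) (1F , _) (inj₁ (a , _)) = contradiction a (path-irrefl {3} {1F})
  cover (2F , _) (2F , _) (inj₁ (a , _)) = contradiction a (path-irrefl {3} {2F})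
  cover (0F , _) (2F , _) (inj₁ (inj₁ () , _))
  cover (0F , _) (2F , _) (inj₁ (inj₂ () , _))
  cover (2F , _) (0F , _) (inj₁ (inj₁ () , _))
  cover (2F , _) (0F , _) (inj₁ (inj₂ () , _))

-- The bodyguard on side z of the ladder: opposite the president, or on the president's
-- side and displaced by s. Since it never changes side, it can be placed alone.
module Ladder {m : ℕ} (s : Fin m → Fin m) (s-hom : Hom (Path m) (Path m) s)
              (move-s : ∀ y → Move (Path m) y (s y)) where

  shift : Fin 2 → Fin 2 → Fin m → Fin m
  shift 0F 0F = s
  shift 0F 1F = id
  shift 1F 0F = id
  shift 1F 1F = s

  rail : Fin 2 → V (Grid 2 m) → V (Grid 2 m)
  rail z (x , y) = z , shift z x y

  -- When the president crosses over, the shift switches between `id` and `s`; by `move-s` one step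
  -- along the rail makes up for it.
  rail-hom : ∀ z → Hom (Grid 2 m) (Grid 2 m) (rail z)
  rail-hom z = grid-hom (λ {x} {x'} _ → move₂ (change z x x')) (λ {x} → move₂ ∘ shift-hom z x)
    where
    change : ∀ z x x' {y} → Move (Path m) (shift z x y) (shift z x' y)
    change z  0F 0F = inj₁ refl
    change z  1F 1F = inj₁ refl
    change 0F 0F 1F = path-sym (move-s _)
    change 0F 1F 0F = move-s _
    change 1F 0F 1F = move-s _
    change 1F 1F 0F = path-sym (move-s _)
    shift-hom : ∀ z x → Hom (Path m) (Path m) (shift z x)
    shift-hom 0F 0F = s-hom
    shift-hom 0F 1F = id
    shift-hom 1F 0F = id
    shift-hom 1F 1F = s-hom

  rail-same : ∀ x y → rail x (x , y) ≡ (x , s y)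
  rail-same 0F y = refl
  rail-same 1F y = refl

  rail-across : ∀ x x' y → Adj (Path 2) x x' → rail x' (x , y) ≡ (x' , y)
  rail-across 0F 1F y _ = refl
  rail-across 1F 0F y _ = refl
  rail-across 0F 0F y a = contradiction a (path-irrefl {2} {0F})
  rail-across 1F 1F y a = contradiction a (path-irrefl {2} {1F})

-- The rail on the president's side covers the neighbour ahead, the other rail the one across; the
-- third bodyguard takes the neighbour behind.
win₃ : ∀ m → BodyguardsWin (Grid 2 (suc m)) 3
win₃ m = targets-win 2 T hom (λ _ → refl) cover (zero , zero)
  where
  open Ladder {suc m} next next-hom move-next
  G : Graph
  G = Grid 2 (suc m)
  T : Fin 3 → V G → V G
  T 0F (x , y) = x , pred y
  T 1F         = rail 1F
  T 2F         = rail 0F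
  hom : ∀ r → Hom G G (T r)
  hom 0F = product-hom id pred-hom
  hom 1F = rail-hom 1F
  hom 2F = rail-hom 0F
  rail-role : ∀ z → ∃ λ r → ∀ p → T r p ≡ rail z p
  rail-role 0F = 2F , λ _ → refl
  rail-role 1F = 1F , λ _ → refl
  cover : ∀ p w → Adj G p w → ∃ λ r → T r p ≡ w
  cover (x , _) _ (inj₂ (refl , inj₂ e)) = 0F , cong (x ,_) (pred≡ e)
  cover (x , y) _ (inj₂ (refl , inj₁ e)) = let (r , T≡rail) = rail-role x in
    r , trans (T≡rail (x , y)) (trans (rail-same x y) (cong (x ,_) (next≡ e)))
  cover (x , y) (x' , _) (inj₁ (a , refl)) = let (r , T≡rail) = rail-role x' in
    r , trans (T≡rail (x , y)) (rail-across x x' y a)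

-- Here `opposite y` is the only neighbour along a side, so the two rails cover everything.
win₂ : BodyguardsWin (Grid 2 2) 2
win₂ = targets-win 1 T hom (λ _ → refl) cover (zero , zero)
  where
  move-opposite : ∀ y → Move (Path 2) y (opposite y)
  move-opposite 0F = inj₂ (inj₁ refl)
  move-opposite 1F = inj₂ (inj₂ refl)
  open Ladder {2} opposite opposite-hom move-opposite
  G : Graph
  G = Grid 2 2
  T : Fin 2 → V G → V G
  T = rail ∘ opposite
  hom : ∀ r → Hom G G (T r)
  hom r = rail-hom (opposite r)
  opposite≡ : ∀ (y y' : Fin 2) → Adj (Path 2) y y' → opposite y ≡ y'
  opposite≡ 0F 1F _ = refl
  opposite≡ 1F 0F _ = refl
  opposite≡ 0F 0F a = contradiction a (path-irrefl {2} {0F})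
  opposite≡ 1F 1F a = contradiction a (path-irrefl {2} {1F})
  rail-role : ∀ z → ∃ λ r → ∀ p → T r p ≡ rail z p
  rail-role z = opposite z , λ p → cong (λ z → rail z p) (opposite-involutive z)
  cover : ∀ p w → Adj G p w → ∃ λ r → T r p ≡ w
  cover (x , y) (_ , y') (inj₂ (refl , a)) = let (r , T≡rail) = rail-role x in
    r , trans (T≡rail (x , y)) (trans (rail-same x y) (cong (x ,_) (opposite≡ y y' a)))
  cover (x , y) (x' , _) (inj₁ (a , refl)) = let (r , T≡rail) = rail-role x' in
    r , trans (T≡rail (x , y)) (rail-across x x' y a)

-- Lower bounds

degree-bound : ∀ (G : Graph) {k} (p : V G) (nbr : Fin k → V G) →
  (∀ d → Adj G p (nbr d)) → (∀ d d' → nbr d ≡ nbr d' → d ≡ d') →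
  ∀ j → j < k → ¬ BodyguardsWin G j
degree-bound G {k} p nbr adj inj j j<k (σ , wins) = clash
  where
  τ : PStrategy G j
  τ = record { place = λ _ → p ; move = λ _ _ q → q , inj₁ refl }
  pres≡p : ∀ t → proj₂ (proj₂ (run G σ τ t)) ≡ p
  pres≡p zero    = refl
  pres≡p (suc t) = pres≡p t
  N : ℕ
  N = proj₁ (wins τ)
  c : Config G j
  c = proj₁ (afterBTurn G σ τ N)
  sur : Surrounded G c p
  sur = subst (Surrounded G c) (pres≡p N) (proj₂ (wins τ) N ℕ.≤-refl)
  guard : Fin k → Fin j
  guard d = proj₁ (sur (nbr d) (adj d))
  clash : ⊥
  clash with pigeonhole j<k guard
  ... | d , d' , d<d' , e = ℕ.<⇒≢ d<d' (cong toℕ (inj d d'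
    (trans (sym (proj₂ (sur _ (adj d)))) (trans (cong c e) (proj₂ (sur _ (adj d')))))))

-- Matchings between bodyguards and neighbours on the 4 × 4 board

Q : Graph
Q = Grid 4 4

-- The neighbours of (1 , 1).
nbr : Fin 4 → V Q
nbr 0F = 0F , 1F
nbr 1F = 1F , 0F
nbr 2F = 2F , 1F
nbr 3F = 1F , 2F

nbr-injective : ∀ d d' → nbr d ≡ nbr d' → d ≡ d'
nbr-injective = toWitness {a? = all? λ d → all? λ d' → (nbr d ≟ᵥ nbr d') →-dec (d ≟ d')} tt

reflect₁ reflect₂ : V Q → V Q
reflect₁ (x , y) = opposite x , y
reflect₂ (x , y) = x , opposite y

Inj : ∀ {k j} → (Fin k → Fin j) → Set
Inj f = ∀ d d' → f d ≡ f d' → d ≡ d'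

inj? : ∀ {k j} (f : Fin k → Fin j) → Dec (Inj f)
inj? f = all? λ d → all? λ d' → (f d ≟ f d') →-dec (d ≟ d')

-- What surrounding `(1 , 1)` on the coming turn requires: distinct bodyguards, each within one move
-- of its neighbour.
Match : ∀ {j} → (Fin j → V Q) → (Fin 4 → Fin j) → Set
Match C f = Inj f × (∀ d → Move Q (C (f d)) (nbr d))

match? : ∀ {j} (C : Fin j → V Q) (f : Fin 4 → Fin j) → Dec (Match C f)
match? C f = inj? f ×-dec (all? λ d → gridMove? (C (f d)) (nbr d))

match-cong : ∀ {j} {C D : Fin j → V Q} {f : Fin 4 → Fin j} → (∀ i → C i ≡ D i) → Match C f → Match D f
match-cong {f = f} e (inj , near) = inj , λ d → subst (λ v → Move Q v (nbr d)) (e (f d)) (near d)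

match-≗ : ∀ {j} {C : Fin j → V Q} {f g : Fin 4 → Fin j} → (∀ d → f d ≡ g d) → Match C f → Match C g
match-≗ {C = C} e (inj , near) =
  (λ d d' gd≡gd' → inj d d' (trans (e d) (trans gd≡gd' (sym (e d'))))) ,
  (λ d → subst (λ i → Move Q (C i) (nbr d)) (e d) (near d))

-- Putting `i` in front of the values of `f` forces a repetition, which by injectivity involves `i`.
injective⇒surjective : ∀ {j k} {f : Fin k → Fin j} → j ≤ k → Inj f → ∀ i → ∃ λ d → f d ≡ i
injective⇒surjective {f = f} j≤k inj i with pigeonhole (s≤s j≤k) (i Vector.∷ f)
... | zero  , suc d  , _        , i≡fd  = d , sym i≡fd
... | suc d , suc d' , s≤s d<d' , fd≡fd' = contradiction (cong toℕ (inj d d' fd≡fd')) (ℕ.<⇒≢ d<d')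

-- Passing to an adjacent central vertex translates every neighbour by one; in the reflected
-- numbering, `d` becomes `mirror₁ d` or `mirror₂ d`. Exchanging the coordinates acts as `diagonal`.
mirror₁ diagonal mirror₂ : Fin 4 → Fin 4
mirror₁ 0F = 2F
mirror₁ 1F = 1F
mirror₁ 2F = 0F
mirror₁ 3F = 3F
diagonal 0F = 1F
diagonal 1F = 0F
diagonal 2F = 3F
diagonal 3F = 2F
mirror₂ = diagonal ∘ mirror₁ ∘ diagonal

diagonal-involutive : ∀ d → diagonal (diagonal d) ≡ d
diagonal-involutive = toWitness {a? = all? λ d → diagonal (diagonal d) ≟ d} tt

module _ (r : V Q → V Q) (o : Fin 4 → Fin 4) where

  -- For `reflect₁` and `id`: only the bodyguard for `(2 , 1)` can also reach `(3 , 1)`, and only it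
  -- or the one for `(1 , 0)` can reach `(2 , 0)`; likewise `(1 , 2)` and `(2 , 2)`. The map `o`
  -- transports this to the other direction.
  Separated : Set
  Separated = ∀ d x y → Move Q (x , y) (nbr d) →
    (Move Q (r (x , y)) (nbr (o 0F)) → d ≡ o 2F) ×
    (Move Q (r (x , y)) (nbr (o 1F)) → d ≡ o 1F ⊎ d ≡ o 2F) ×
    (Move Q (r (x , y)) (nbr (o 3F)) → d ≡ o 3F ⊎ d ≡ o 2F)

  separated? : Dec Separated
  separated? = all? λ d → all? λ x → all? λ y → gridMove? (x , y) (nbr d) →-dec
    (gridMove? (r (x , y)) (nbr (o 0F)) →-dec (d ≟ o 2F)) ×-dec
    (gridMove? (r (x , y)) (nbr (o 1F)) →-dec ((d ≟ o 1F) ⊎-dec (d ≟ o 2F))) ×-dec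
    (gridMove? (r (x , y)) (nbr (o 3F)) →-dec ((d ≟ o 3F) ⊎-dec (d ≟ o 2F)))

  -- At most four bodyguards means that both matchings use all of them; g is then determined
  -- by elimination, starting from the vertex o 0F, which only the bodyguard f (o 2F) can reach.
  match-reflected : ∀ {j} {C : Fin j → V Q} {f g : Fin 4 → Fin j} → Inj o → Separated → j ≤ 4 →
    Match C f → Match (r ∘ C) g → ∀ d → g (o (mirror₁ d)) ≡ f (o d)
  match-reflected {C = C} {f} {g} o-inj sep j≤4 (f-inj , f-near) (g-inj , g-near) =
    λ { 0F → g₂ ; 1F → g₁ ; 2F → g₀ ; 3F → g₃ }
    where
    f⁻¹ : ∀ i → ∃ λ d → f d ≡ i
    f⁻¹ = injective⇒surjective j≤4 f-inj
    near : ∀ {d d'} → f d ≡ g d' → Move Q (r (C (f d))) (nbr d')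
    near {d' = d'} eq = subst (λ i → Move Q (r (C i)) (nbr d')) (sym eq) (g-near d')
    go-inj : Inj (g ∘ o)
    go-inj d d' = o-inj d d' ∘ g-inj (o d) (o d')
    g₀ : g (o 0F) ≡ f (o 2F)
    g₀ with f⁻¹ (g (o 0F))
    ... | d , eq with proj₁ (sep d _ _ (f-near d)) (near eq)
    ...   | refl = sym eq
    g₁ : g (o 1F) ≡ f (o 1F)
    g₁ with f⁻¹ (g (o 1F))
    ... | d , eq with proj₁ (proj₂ (sep d _ _ (f-near d))) (near eq)
    ...   | inj₁ refl = sym eq
    ...   | inj₂ refl = contradiction (go-inj 0F 1F (trans g₀ eq)) λ ()
    g₃ : g (o 3F) ≡ f (o 3F)
    g₃ with f⁻¹ (g (o 3F))
    ... | d , eq with proj₂ (proj₂ (sep d _ _ (f-near d))) (near eq)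
    ...   | inj₁ refl = sym eq
    ...   | inj₂ refl = contradiction (go-inj 0F 3F (trans g₀ eq)) λ ()
    g₂ : g (o 2F) ≡ f (o 0F)
    g₂ with f⁻¹ (g (o 2F))
    ... | d , eq with injective⇒surjective ℕ.≤-refl o-inj d
    ...   | 0F , refl = sym eq
    ...   | 1F , refl = contradiction (go-inj 1F 2F (trans g₁ eq)) λ ()
    ...   | 2F , refl = contradiction (go-inj 0F 2F (trans g₀ eq)) λ ()
    ...   | 3F , refl = contradiction (go-inj 3F 2F (trans g₃ eq)) λ ()

match-mirror₁ : ∀ {j} {C : Fin j → V Q} {f g : Fin 4 → Fin j} → j ≤ 4 →
  Match C f → Match (reflect₁ ∘ C) g → ∀ d → g (mirror₁ d) ≡ f d
match-mirror₁ {C = C} = match-reflected reflect₁ id {C = C} (λ _ _ → id)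
  (toWitness {a? = separated? reflect₁ id} tt)

match-mirror₂ : ∀ {j} {C : Fin j → V Q} {f g : Fin 4 → Fin j} → j ≤ 4 →
  Match C f → Match (reflect₂ ∘ C) g → ∀ d → g (mirror₂ d) ≡ f d
match-mirror₂ {C = C} {f} j≤4 F H d = trans
  (match-reflected reflect₂ diagonal {C = C} (toWitness {a? = inj? diagonal} tt)
    (toWitness {a? = separated? reflect₂ diagonal} tt) j≤4 F H (diagonal d))
  (cong f (diagonal-involutive d))

-- With the reflections undone, the vertex is within one of `nbr d` and of its translates by one in
-- each coordinate; only `nbr d` itself is.
pinned : ∀ d x y → Move Q (x , y) (nbr d) → Move Q (reflect₁ (x , y)) (nbr (mirror₁ d)) →
  Move Q (reflect₂ (x , y)) (nbr (mirror₂ d)) → (x , y) ≡ nbr d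
pinned = toWitness {a? = all? λ d → all? λ x → all? λ y →
  gridMove? (x , y) (nbr d) →-dec gridMove? (reflect₁ (x , y)) (nbr (mirror₁ d)) →-dec
  gridMove? (reflect₂ (x , y)) (nbr (mirror₂ d)) →-dec ((x , y) ≟ᵥ nbr d)} tt

-- If at most four bodyguards threaten to surround (1 , 1) and both central vertices adjacent to it,
-- then they already surround (1 , 1).
match-exact : ∀ {j} {C : Fin j → V Q} {f g h : Fin 4 → Fin j} → j ≤ 4 →
  Match C f → Match (reflect₁ ∘ C) g → Match (reflect₂ ∘ C) h → ∀ d → C (f d) ≡ nbr d
match-exact {C = C} j≤4 F H₁ H₂ d = pinned d _ _ (proj₂ F d)
  (subst (λ i → Move Q (reflect₁ (C i)) (nbr (mirror₁ d))) (match-mirror₁ {C = C} j≤4 F H₁ d) (proj₂ H₁ (mirror₁ d)))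
  (subst (λ i → Move Q (reflect₂ (C i)) (nbr (mirror₂ d))) (match-mirror₂ {C = C} j≤4 F H₂ d) (proj₂ H₂ (mirror₂ d)))

nbr-far : ∀ d → ¬ Move Q (reflect₁ (reflect₂ (nbr d))) (nbr 0F)
nbr-far = toWitness {a? = all? λ d → ¬? (gridMove? (reflect₁ (reflect₂ (nbr d))) (nbr 0F))} tt

-- Retraction of a large grid onto a 4 × 4 corner

clamp : ∀ {n} → Fin (4 + n) → Fin 4
clamp 0F                  = 0F
clamp 1F                  = 1F
clamp 2F                  = 2F
clamp (suc (suc (suc _))) = 3F

clamp-hom : ∀ {n} → Hom (Path (4 + n)) (Path 4) clamp
clamp-hom = path-hom λ {i} {j} → lip i j
  where
  lip : ∀ {n} (i j : Fin (4 + n)) → toℕ i ≤ suc (toℕ j) → toℕ (clamp i) ≤ suc (toℕ (clamp j))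
  lip 0F                  _                   _               = z≤n
  lip 1F                  _                   _               = s≤s z≤n
  lip 2F                  0F                  (s≤s ())
  lip 2F                  1F                  _               = s≤s (s≤s z≤n)
  lip 2F                  2F                  _               = s≤s (s≤s z≤n)
  lip 2F                  (suc (suc (suc _))) _               = s≤s (s≤s z≤n)
  lip (suc (suc (suc _))) 0F                  (s≤s ())
  lip (suc (suc (suc _))) 1F                  (s≤s (s≤s ()))
  lip (suc (suc (suc _))) 2F                  _               = s≤s (s≤s (s≤s z≤n))
  lip (suc (suc (suc _))) (suc (suc (suc _))) _               = s≤s (s≤s (s≤s z≤n))

flip : Fin 2 → Fin 4 → Fin 4
flip 0F = id
flip 1F = opposite

flip-hom : ∀ b → Hom (Path 4) (Path 4) (flip b)
flip-hom 0F = id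
flip-hom 1F = opposite-hom

flip-opposite : ∀ b x → flip (opposite b) x ≡ opposite (flip b x)
flip-opposite 0F x = refl
flip-opposite 1F x = sym (opposite-involutive x)

flip-clamp : ∀ {n} b x → flip b (clamp (flip b x ↑ˡ n)) ≡ x
flip-clamp 0F 0F = refl
flip-clamp 0F 1F = refl
flip-clamp 0F 2F = refl
flip-clamp 0F 3F = refl
flip-clamp 1F 0F = refl
flip-clamp 1F 1F = refl
flip-clamp 1F 2F = refl
flip-clamp 1F 3F = refl

centre-adj₀ : ∀ {n} b → Adj (Path (4 + n)) (flip b 1F ↑ˡ n) (flip b 0F ↑ˡ n)
centre-adj₀ 0F = inj₂ refl
centre-adj₀ 1F = inj₁ refl

centre-adj₂ : ∀ {n} b → Adj (Path (4 + n)) (flip b 1F ↑ˡ n) (flip b 2F ↑ˡ n)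
centre-adj₂ 0F = inj₁ refl
centre-adj₂ 1F = inj₂ refl

centre-adj : ∀ {n} b → Adj (Path (4 + n)) (flip b 1F ↑ˡ n) (flip (opposite b) 1F ↑ˡ n)
centre-adj 0F = inj₁ refl
centre-adj 1F = inj₂ refl

-- The president's escape from at most four bodyguards

module FourGuards (n m : ℕ) {j : ℕ} (j≤4 : j ≤ 4) where

  G : Graph
  G = Grid (4 + n) (4 + m)

  -- One of the four central vertices of the 4 × 4 corner of the board.
  Corner : Set
  Corner = Fin 2 × Fin 2

  flip₁ flip₂ : Corner → Corner
  flip₁ (b₁ , b₂) = opposite b₁ , b₂
  flip₂ (b₁ , b₂) = b₁ , opposite b₂

  -- Retract the board onto the 4 × 4 corner, reflected so that the given central vertex is (1 , 1).
  view : Corner → V G → V Q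
  view (b₁ , b₂) (x , y) = flip b₁ (clamp x) , flip b₂ (clamp y)

  embed : Corner → V Q → V G
  embed (b₁ , b₂) (x , y) = flip b₁ x ↑ˡ n , flip b₂ y ↑ˡ m

  centre : Corner → V G
  centre b = embed b (1F , 1F)

  view-hom : ∀ b → Hom G Q (view b)
  view-hom (b₁ , b₂) = product-hom (flip-hom b₁ ∘ clamp-hom) (flip-hom b₂ ∘ clamp-hom)

  view-embed : ∀ b q → view b (embed b q) ≡ q
  view-embed (b₁ , b₂) (x , y) = cong₂ _,_ (flip-clamp b₁ x) (flip-clamp b₂ y)

  view-flip₁ : ∀ b v → view (flip₁ b) v ≡ reflect₁ (view b v)
  view-flip₁ (b₁ , b₂) (x , y) = cong (_, _) (flip-opposite b₁ _)

  view-flip₂ : ∀ b v → view (flip₂ b) v ≡ reflect₂ (view b v)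
  view-flip₂ (b₁ , b₂) (x , y) = cong (_ ,_) (flip-opposite b₂ _)

  nbr-adj : ∀ b d → Adj G (centre b) (embed b (nbr d))
  nbr-adj (b₁ , b₂) 0F = inj₁ (centre-adj₀ b₁ , refl)
  nbr-adj (b₁ , b₂) 1F = inj₂ (refl , centre-adj₀ b₂)
  nbr-adj (b₁ , b₂) 2F = inj₁ (centre-adj₂ b₁ , refl)
  nbr-adj (b₁ , b₂) 3F = inj₂ (refl , centre-adj₂ b₂)

  -- Assignments are coded as numbers below `j ^ 4`, so that a finite search decides whether a
  -- matching exists.
  Threat : Corner → Config G j → Set
  Threat b c = ∃ λ (k : Fin (j ^ 4)) → Match (view b ∘ c) (finToFun k)

  threat? : ∀ b c → Dec (Threat b c)
  threat? b c = any? λ k → match? (view b ∘ c) (finToFun k)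

  ShadowSurrounded : Corner → Config G j → Set
  ShadowSurrounded b c = ∀ d → ∃ λ i → view b (c i) ≡ nbr d

  surrounded⇒shadow : ∀ b c → Surrounded G c (centre b) → ShadowSurrounded b c
  surrounded⇒shadow b c sur d =
    let (i , e) = sur _ (nbr-adj b d) in i , trans (cong (view b) e) (view-embed b (nbr d))

  shadow⇒threat : ∀ b c c' → BMove G c c' → ShadowSurrounded b c' → Threat b c
  shadow⇒threat b c c' mv sur = funToFin f , match-≗ {C = view b ∘ c} (sym ∘ finToFun-funToFin f)
    ( (λ d d' e → nbr-injective d d'
        (trans (sym (proj₂ (sur d))) (trans (cong (view b ∘ c') e) (proj₂ (sur d')))))
    , (λ d → subst (Move Q (view b (c (f d)))) (proj₂ (sur d)) (view-hom b (mv (f d)))) )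
    where
    f : Fin 4 → Fin j
    f d = proj₁ (sur d)

  threats⇒exact : ∀ b c → ((k , _) : Threat b c) → Threat (flip₁ b) c → Threat (flip₂ b) c →
    ∀ d → view b (c (finToFun k d)) ≡ nbr d
  threats⇒exact b c (_ , F) (_ , H₁) (_ , H₂) = match-exact {C = view b ∘ c} j≤4 F
    (match-cong (view-flip₁ b ∘ c) H₁) (match-cong (view-flip₂ b ∘ c) H₂)

  escape : ∀ b c → ¬ ShadowSurrounded b c →
    ∃ λ b' → Move G (centre b) (centre b') × ¬ Threat b' c
  escape b@(b₁ , b₂) c ¬sur with threat? b c | threat? (flip₁ b) c | threat? (flip₂ b) c
  ... | no ¬th | _      | _      = b , inj₁ refl , ¬th
  ... | _      | no ¬th | _      = flip₁ b , move₁ (inj₂ (centre-adj b₁)) , ¬th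
  ... | _      | _      | no ¬th = flip₂ b , move₂ (inj₂ (centre-adj b₂)) , ¬th
  ... | yes th | yes th₁ | yes th₂ =
    contradiction (λ d → finToFun (proj₁ th) d , threats⇒exact b c th th₁ th₂ d) ¬sur

  -- Threats at `(1 , 1)` and its two central neighbours put every bodyguard's image on a neighbour
  -- of `(1 , 1)`. None of these is within one move of `(3 , 2)`, which a threat at `(2 , 2)` would
  -- require.
  unthreatened : ∀ c → ∃ λ b → ¬ Threat b c
  unthreatened c with threat? (0F , 0F) c | threat? (1F , 0F) c | threat? (0F , 1F) c | threat? (1F , 1F) c
  ... | no ¬th | _ | _ | _ = (0F , 0F) , ¬th
  ... | _ | no ¬th | _ | _ = (1F , 0F) , ¬th
  ... | _ | _ | no ¬th | _ = (0F , 1F) , ¬th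
  ... | _ | _ | _ | no ¬th = (1F , 1F) , ¬th
  ... | yes th@(k , f-inj , _) | yes th₁ | yes th₂ | yes (k' , _ , near)
    with injective⇒surjective j≤4 f-inj (finToFun {j} {4} k' 0F)
  ...   | d , e = contradiction
    (subst (λ v → Move Q (reflect₁ (reflect₂ v)) (nbr 0F))
      (trans (cong (view (0F , 0F) ∘ c) (sym e)) (threats⇒exact (0F , 0F) c th th₁ th₂ d)) (near 0F))
    (nbr-far d)

  Refuge : Config G j → V G → Corner → Set
  Refuge c p b = Move G p (centre b) × ¬ Threat b c

  refuge? : ∀ c p → Dec (∃ λ b₁ → ∃ λ b₂ → Refuge c p (b₁ , b₂))
  refuge? c p = any? λ b₁ → any? λ b₂ → gridMove? p (centre (b₁ , b₂)) ×-dec ¬? (threat? (b₁ , b₂) c)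

  flee : Config G j → ∀ p → Σ (V G) (Move G p)
  flee c p with refuge? c p
  ... | yes (b₁ , b₂ , mv , _) = centre (b₁ , b₂) , mv
  ... | no  _                  = p , inj₁ refl

  president : PStrategy G j
  president = record { place = centre ∘ proj₁ ∘ unthreatened ; move = λ _ → flee }

  -- The invariant after each president's turn: without a threat, the coming bodyguard turn cannot
  -- surround the president.
  Safe : Config G j → V G → Set
  Safe c p = ∃ λ b → p ≡ centre b × ¬ Threat b c

  flee-safe : ∀ {c c' p} → BMove G c c' → Safe c p → Safe c' (proj₁ (flee c' p))
  flee-safe {c} {c'} mv (b , refl , ¬th) with refuge? c' (centre b)
  ... | yes (b₁ , b₂ , _ , ¬th') = (b₁ , b₂) , refl , ¬th'
  ... | no none = let (b' , refuge) = escape b c' (¬th ∘ shadow⇒threat b c c' mv)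
                  in contradiction (proj₁ b' , proj₂ b' , refuge) none

  bodyguards-lose : ¬ BodyguardsWin G j
  bodyguards-lose (σ , wins) = unsurrounded
    where
    state : ℕ → History G j × Config G j × V G
    state = run G σ president
    bmove : ∀ t → BMove G (proj₁ (proj₂ (state t))) (proj₁ (proj₂ (state (suc t))))
    bmove t = proj₂ (BStrategy.move σ (proj₁ (state t)) (proj₁ (proj₂ (state t))) (proj₂ (proj₂ (state t))))
    safe : ∀ t → Safe (proj₁ (proj₂ (state t))) (proj₂ (proj₂ (state t)))
    safe zero    = let (b , ¬th) = unthreatened (BStrategy.place σ) in b , refl , ¬th
    safe (suc t) = flee-safe (bmove t) (safe t)
    N : ℕ
    N = proj₁ (wins president)
    unsurrounded : ⊥
    unsurrounded = let (b , e , ¬th) = safe N in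
      ¬th (shadow⇒threat b _ _ (bmove N) (surrounded⇒shadow b _
        (subst (Surrounded G _) e (proj₂ (wins president) N ℕ.≤-refl))))

theorem4p6 : (n m : ℕ) → 1 ≤ n → n ≤ m →
    ((n ≡ 2 → m ≡ 2 → BodyguardNumberIs (Path n □ Path m) 2)
    × (n ≡ 2 → 3 ≤ m → BodyguardNumberIs (Path n □ Path m) 3)
    × (n ≡ 3 → 3 ≤ m → BodyguardNumberIs (Path n □ Path m) 4)
    × (4 ≤ n → 4 ≤ m → BodyguardNumberIs (Path n □ Path m) 5))
theorem4p6 n m _ _ = two , three , four , five
  where
  two : n ≡ 2 → m ≡ 2 → BodyguardNumberIs (Path n □ Path m) 2
  two refl refl = win₂ , degree-bound (Grid 2 2) (0F , 0F) nbrs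
    (λ { 0F → inj₂ (refl , inj₁ refl) ; 1F → inj₁ (inj₁ refl , refl) })
    (λ { 0F 0F _ → refl ; 1F 1F _ → refl ; 0F 1F () ; 1F 0F () })
    where
    nbrs : Fin 2 → V (Grid 2 2)
    nbrs 0F = 0F , 1F
    nbrs 1F = 1F , 0F
  three : n ≡ 2 → 3 ≤ m → BodyguardNumberIs (Path n □ Path m) 3
  -- As `3 ≤ m`, the vertex `(0 , 1)` is not a corner and has degree three.
  three refl (s≤s (s≤s (s≤s {n = m'} _))) = win₃ (2 + m') , degree-bound (Grid 2 (3 + m')) (0F , 1F) nbrs
    (λ { 0F → inj₂ (refl , inj₂ refl) ; 1F → inj₂ (refl , inj₁ refl) ; 2F → inj₁ (inj₁ refl , refl) })
    (λ { 0F 0F _ → refl ; 1F 1F _ → refl ; 2F 2F _ → refl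
       ; 0F 1F () ; 0F 2F () ; 1F 0F () ; 1F 2F () ; 2F 0F () ; 2F 1F () })
    where
    nbrs : Fin 3 → V (Grid 2 (3 + m'))
    nbrs 0F = 0F , 0F
    nbrs 1F = 0F , 2F
    nbrs 2F = 1F , 1F
  four : n ≡ 3 → 3 ≤ m → BodyguardNumberIs (Path n □ Path m) 4
  four refl (s≤s (s≤s (s≤s {n = m'} _))) = win₄ (2 + m') , degree-bound (Grid 3 (3 + m')) (1F , 1F) nbrs
    (λ { 0F → inj₁ (inj₂ refl , refl) ; 1F → inj₂ (refl , inj₂ refl)
       ; 2F → inj₁ (inj₁ refl , refl) ; 3F → inj₂ (refl , inj₁ refl) })
    (λ { 0F 0F _ → refl ; 1F 1F _ → refl ; 2F 2F _ → refl ; 3F 3F _ → refl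
       ; 0F 1F () ; 0F 2F () ; 0F 3F () ; 1F 0F () ; 1F 2F () ; 1F 3F ()
       ; 2F 0F () ; 2F 1F () ; 2F 3F () ; 3F 0F () ; 3F 1F () ; 3F 2F () })
    where
    nbrs : Fin 4 → V (Grid 3 (3 + m'))
    nbrs 0F = 0F , 1F
    nbrs 1F = 1F , 0F
    nbrs 2F = 2F , 1F
    nbrs 3F = 1F , 2F
  five : 4 ≤ n → 4 ≤ m → BodyguardNumberIs (Path n □ Path m) 5
  five (s≤s (s≤s (s≤s (s≤s {n = n'} _)))) (s≤s (s≤s (s≤s (s≤s {n = m'} _)))) =
    win₅ (3 + n') (3 + m') , λ j j<5 → FourGuards.bodyguards-lose n' m' (s≤s⁻¹ j<5)
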